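{- Let $(a_0,a_1)\in\mathbb{Z}^2$ with $\max\{|a_0|,|a_1|\}\le 10$ and let $\lambda\in\,]-2,2[$. Then the integer sequence $(a_n)_{n\ge 0}$ determined by the initial values $a_0,a_1$ and the condition $$0\le a_{n+2}+\lambda a_{n+1}+a_n<1\qquad(n\ge 0)$$ is periodic.
   Context: For real $\lambda$ and integers $a_n,a_{n+1}$, the condition $0\le a_{n+2}+\lambda a_{n+1}+a_n<1$ with $a_{n+2}\in\mathbb{Z}$ determines $a_{n+2}$ uniquely, namely $a_{n+2}=-\lfloor \lambda a_{n+1}+a_n\rfloor$. -}

module Defs where

open import Data.Integer as ℤ using (ℤ; +_)
open import Data.Nat as ℕ using (ℕ; suc)
open import Data.Rational as ℚ using (ℚ; _/_; _<_; _+_; _*_; 0ℚ; 1ℚ)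
open import Data.Product using (Σ; ∃; _×_; ∃-syntax)
open import Data.Sum using (_⊎_)
open import Relation.Nullary using (¬_)

ℤ→ℚ : ℤ → ℚ
ℤ→ℚ z = z / 1

-- A real number as a (two-sided, located) Dedekind cut on ℚ:
-- L = {q | q < x}, U = {q | x < q}.
record ℝ : Set₁ where
  field
    L U          : ℚ → Set
    L-inhabited  : ∃[ q ] L q
    U-inhabited  : ∃[ q ] U q
    L-down       : ∀ {p q} → p < q → L q → L p
    U-up         : ∀ {p q} → p < q → U p → U q
    L-rounded    : ∀ {q} → L q → ∃[ r ] (q < r × L r)
    U-rounded    : ∀ {q} → U q → ∃[ r ] (r < q × U r)
    disjoint     : ∀ {q} → ¬ (L q × U q)
    located      : ∀ {p q} → p < q → L p ⊎ U q

open ℝ public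

InOpen : ℝ → ℚ → ℚ → Set
InOpen x a b = L x a × U x b

-- The real inequality  x·b + c < r  (b, c integers, r rational),
-- expressed via the cut: there is a rational enclosure p < x < q of x
-- whose both endpoints satisfy the strict inequality (the map t ↦ t·b + c
-- is monotone, so this is exactly x·b + c < r).
AffLt : ℝ → ℤ → ℤ → ℚ → Set
AffLt x b c r = ∃[ p ] ∃[ q ] (L x p × U x q ×
                 (p * ℤ→ℚ b + ℤ→ℚ c < r) × (q * ℤ→ℚ b + ℤ→ℚ c < r))

AffNonneg : ℝ → ℤ → ℤ → Set
AffNonneg x b c = ¬ AffLt x b c 0ℚ

SRS : ℝ → (ℕ → ℤ) → Set
SRS λ' a = ∀ n → AffNonneg λ' (a (suc n)) (a (suc (suc n)) ℤ.+ a n)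
               × AffLt λ' (a (suc n)) (a (suc (suc n)) ℤ.+ a n) 1ℚ

Periodic : (ℕ → ℤ) → Set
Periodic a = ∃[ p ] (ℕ.NonZero p × (∀ n → a (n ℕ.+ p) ≡ a n))
  where open import Relation.Binary.PropositionalEquality using (_≡_)

{-# OPTIONS --safe #-}

-- The map (aₙ, aₙ₊₁) ↦ (aₙ₊₁, aₙ₊₂) is injective, because the defining condition is symmetric
-- in aₙ and aₙ₊₂.  It is therefore enough that every visit of the orbit to the box
-- max(|x|, |y|) ≤ 10 is followed by another one: by the pigeonhole principle a pair of the box
-- is visited twice, and by injectivity the repetition propagates back to the initial pair.
--
-- By the same symmetry, if aₙ₊₁ = aₙ or aₙ₊₂ = aₙ after the visit of a pair (x, y), the orbit
-- from then on runs through its past backwards, and so it reaches (y, x), which is in the box.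
--
-- Put μ = λ + 2.  For μ > 1/230 the orbit of each of the 441 pairs is followed until it meets
-- the box or such a reflection, narrowing the interval known to contain μ whenever aₙ₊₂ is not
-- determined by it; this is a finite computation.  It also covers the pairs (x, y) with y < 0
-- or y ≤ x when μ < 1/229.  The others climb: the sequence is an arithmetic progression as long
-- as its values are below 1/μ, and then its second difference is −1 until its slope is 0, which
-- gives aₙ₊₁ = aₙ.
module Submission where

open import Defs
open import Data.Nat using (ℕ; _≤_)
open import Data.Integer using (ℤ; ∣_∣)
open import Data.Rational using (ℚ; -_; _/_)
open import Relation.Binary.PropositionalEquality using (_≡_)

open import Data.Bool using (Bool; true; false; T; _∧_; _∨_; if_then_else_)
open import Data.Bool.Properties using (T-≡; T-∧; T-∨)
open import Data.Empty using (⊥; ⊥-elim)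
open import Data.Fin as Fin using (Fin; combine; fromℕ<; toℕ)
import Data.Fin.Properties as Fin
open import Data.Integer as ℤ using (+_; -[1+_]; _⊖_)
import Data.Integer.Properties as ℤ
open import Data.Integer.Solver using (module +-*-Solver)
open import Data.Nat as ℕ using (zero; suc)
open import Data.Nat.DivMod using (m<n*o⇒m/o<n)
import Data.Nat.Properties as ℕ
open import Data.Product using (_×_; _,_; ∃-syntax; proj₁; proj₂)
open import Data.Rational as ℚ using (↥_; ↧_; toℚᵘ; 0ℚ; 1ℚ)
import Data.Rational.Properties as ℚ
open import Data.Rational.Unnormalised as ℚᵘ using (mkℚᵘ)
import Data.Rational.Unnormalised.Properties as ℚᵘ
open import Data.Sum as Sum using (_⊎_; inj₁; inj₂; [_,_]′)
open import Function using (case_of_; Equivalence; _∘_)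
open import Relation.Binary.Definitions using (tri<; tri≈; tri>)
open import Relation.Binary.PropositionalEquality using (refl; sym; trans; cong; cong₂; subst; subst₂)
open import Relation.Nullary using (¬_; yes; no)
open +-*-Solver using (solve; _:=_; _:+_; _:*_; :-_; _:-_; con)

-- Clearing denominators in rational inequalities.

affine-ℚᵘ : ∀ q b c →
  toℚᵘ (q ℚ.* ℤ→ℚ b ℚ.+ ℤ→ℚ c) ℚᵘ.≃ mkℚᵘ (↥ q ℤ.* b ℤ.+ c ℤ.* ↧ q) (ℚ.denominator-1 q)
affine-ℚᵘ q@record{} b c = ℚᵘ.≃-trans (ℚ.toℚᵘ-homo-+ (q ℚ.* ℤ→ℚ b) (ℤ→ℚ c))
  (ℚᵘ.≃-trans (ℚᵘ.+-cong (ℚᵘ.≃-trans (ℚ.toℚᵘ-homo-* q (ℤ→ℚ b))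
                            (ℚᵘ.*-congˡ {toℚᵘ q} (ℚ.toℚᵘ-fromℚᵘ (mkℚᵘ b 0))))
                          (ℚ.toℚᵘ-fromℚᵘ (mkℚᵘ c 0)))
              (ℚᵘ.*≡* (ring (ℕ.*-identityʳ D) (trans (ℕ.*-identityʳ _) (ℕ.*-identityʳ D)))))
  where
  D = ℚ.denominatorℕ q
  ring : ∀ {E F} → E ≡ D → F ≡ D →
    (↥ q ℤ.* b ℤ.* + 1 ℤ.+ c ℤ.* + E) ℤ.* ↧ q ≡ (↥ q ℤ.* b ℤ.+ c ℤ.* ↧ q) ℤ.* + F
  ring refl refl =
    solve 4 (λ n b c d → (n :* b :* con (+ 1) :+ c :* d) :* d := (n :* b :+ c :* d) :* d) refl
      (↥ q) b c (↧ q)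

affine-<⁻ : ∀ q b c r → q ℚ.* ℤ→ℚ b ℚ.+ ℤ→ℚ c ℚ.< ℤ→ℚ r → ↥ q ℤ.* b ℤ.+ c ℤ.* ↧ q ℤ.< r ℤ.* ↧ q
affine-<⁻ q b c r lt
  with ℚᵘ.*<* p ← ℚᵘ.<-respʳ-≃ (ℚ.toℚᵘ-fromℚᵘ (mkℚᵘ r 0))
                    (ℚᵘ.<-respˡ-≃ (affine-ℚᵘ q b c) (ℚ.toℚᵘ-mono-< lt))
  = subst (ℤ._< _) (ℤ.*-identityʳ _) p

affine-<⁺ : ∀ q b c r → ↥ q ℤ.* b ℤ.+ c ℤ.* ↧ q ℤ.< r ℤ.* ↧ q → q ℚ.* ℤ→ℚ b ℚ.+ ℤ→ℚ c ℚ.< ℤ→ℚ r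
affine-<⁺ q b c r lt = ℚ.toℚᵘ-cancel-<
  (ℚᵘ.<-respʳ-≃ (ℚᵘ.≃-sym (ℚ.toℚᵘ-fromℚᵘ (mkℚᵘ r 0)))
  (ℚᵘ.<-respˡ-≃ (ℚᵘ.≃-sym (affine-ℚᵘ q b c)) (ℚᵘ.*<* (subst (ℤ._< _) (sym (ℤ.*-identityʳ _)) lt))))

/-<⁺ : ∀ i d j e → i ℤ.* + suc e ℤ.< j ℤ.* + suc d → i / suc d ℚ.< j / suc e
/-<⁺ i d j e lt = ℚ.toℚᵘ-cancel-<
  (ℚᵘ.<-respʳ-≃ (ℚᵘ.≃-sym (ℚ.toℚᵘ-fromℚᵘ (mkℚᵘ j e)))
  (ℚᵘ.<-respˡ-≃ (ℚᵘ.≃-sym (ℚ.toℚᵘ-fromℚᵘ (mkℚᵘ i d))) (ℚᵘ.*<* lt)))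

/-≤⁺ : ∀ i d j e → i ℤ.* + suc e ℤ.≤ j ℤ.* + suc d → i / suc d ℚ.≤ j / suc e
/-≤⁺ i d j e le = ℚ.toℚᵘ-cancel-≤
  (ℚᵘ.≤-respʳ-≃ (ℚᵘ.≃-sym (ℚ.toℚᵘ-fromℚᵘ (mkℚᵘ j e)))
  (ℚᵘ.≤-respˡ-≃ (ℚᵘ.≃-sym (ℚ.toℚᵘ-fromℚᵘ (mkℚᵘ i d))) (ℚᵘ.*≤* le)))

↥/↧ : ∀ q → ↥ q / suc (ℚ.denominator-1 q) ≡ q
↥/↧ q@record{} = ℚ.fromℚᵘ-toℚᵘ q

/-<⁻ : ∀ q i m → q ℚ.< i / suc m → ↥ q ℤ.* + suc m ℤ.< i ℤ.* ↧ q
/-<⁻ q@record{} i m lt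
  with ℚᵘ.*<* p ← ℚᵘ.<-respʳ-≃ (ℚ.toℚᵘ-fromℚᵘ (mkℚᵘ i m)) (ℚ.toℚᵘ-mono-< lt) = p

/->⁻ : ∀ q i m → i / suc m ℚ.< q → i ℤ.* ↧ q ℤ.< ↥ q ℤ.* + suc m
/->⁻ q@record{} i m lt
  with ℚᵘ.*<* p ← ℚᵘ.<-respˡ-≃ (ℚ.toℚᵘ-fromℚᵘ (mkℚᵘ i m)) (ℚ.toℚᵘ-mono-< lt) = p

translate-< : ∀ k {i j i′ j′} → i ℤ.+ k ≡ i′ → j ℤ.+ k ≡ j′ → i ℤ.< j → i′ ℤ.< j′
translate-< k refl refl = ℤ.+-monoˡ-< k

translate-≤ : ∀ k {i j i′ j′} → i ℤ.+ k ≡ i′ → j ℤ.+ k ≡ j′ → i ℤ.≤ j → i′ ℤ.≤ j′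
translate-≤ k refl refl = ℤ.+-monoˡ-≤ k

-- The value of λ for which μ = λ + 2 equals n / (d + 1); only μ > 0 occurs, so n is a natural number.
frac : ℕ → ℕ → ℚ
frac n d = (+ n ℤ.- + (2 ℕ.* suc d)) / suc d

private
  frac-ring : ∀ n d e →
    + (n ℕ.* suc e) ℤ.+ ℤ.- (+ 2 ℤ.* + suc d ℤ.* + suc e) ≡ (+ n ℤ.- + (2 ℕ.* suc d)) ℤ.* + suc e
  frac-ring n d e = trans
    (cong (ℤ._+ ℤ.- (+ 2 ℤ.* + suc d ℤ.* + suc e)) (ℤ.pos-* n (suc e)))
    (solve 3 (λ n d e → n :* e :+ :- (con (+ 2) :* d :* e) := (n :- con (+ 2) :* d) :* e) refl
      (+ n) (+ suc d) (+ suc e))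

  frac-ring′ : ∀ n d e →
    + (n ℕ.* suc d) ℤ.+ ℤ.- (+ 2 ℤ.* + suc d ℤ.* + suc e) ≡ (+ n ℤ.- + (2 ℕ.* suc e)) ℤ.* + suc d
  frac-ring′ n d e = trans
    (cong (λ t → + (n ℕ.* suc d) ℤ.+ ℤ.- t)
      (solve 2 (λ d e → con (+ 2) :* d :* e := con (+ 2) :* e :* d) refl (+ suc d) (+ suc e)))
    (frac-ring n e d)

frac-mono-< : ∀ {n d n′ e} → n ℕ.* suc e ℕ.< n′ ℕ.* suc d → frac n d ℚ.< frac n′ e
frac-mono-< {n} {d} {n′} {e} lt =
  /-<⁺ (+ n ℤ.- + (2 ℕ.* suc d)) d (+ n′ ℤ.- + (2 ℕ.* suc e)) e
    (translate-< (ℤ.- (+ 2 ℤ.* + suc d ℤ.* + suc e)) (frac-ring n d e) (frac-ring′ n′ d e) (ℤ.+<+ lt))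

frac-mono-≤ : ∀ {n d n′ e} → n ℕ.* suc e ℕ.≤ n′ ℕ.* suc d → frac n d ℚ.≤ frac n′ e
frac-mono-≤ {n} {d} {n′} {e} le =
  /-≤⁺ (+ n ℤ.- + (2 ℕ.* suc d)) d (+ n′ ℤ.- + (2 ℕ.* suc e)) e
    (translate-≤ (ℤ.- (+ 2 ℤ.* + suc d ℤ.* + suc e)) (frac-ring n d e) (frac-ring′ n′ d e) (ℤ.+≤+ le))

-- The step relation and the bounds it puts on the cut.

Step : ℝ → ℤ → ℤ → ℤ → Set
Step λ' x y z = AffNonneg λ' y (z ℤ.+ x) × AffLt λ' y (z ℤ.+ x) 1ℚ

Step-sym : ∀ {λ' x y z} → Step λ' x y z → Step λ' z y x
Step-sym {x = x} {z = z} s rewrite ℤ.+-comm z x = s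

module Cut (λ' : ℝ) where

  L-mono : ∀ {p q} → p ℚ.≤ q → L λ' q → L λ' p
  L-mono {p} {q} p≤q Lq with ℚ.<-cmp p q
  ... | tri< p<q _ _ = L-down λ' p<q Lq
  ... | tri≈ _ refl _ = Lq
  ... | tri> _ _ q<p = ⊥-elim (ℚ.<-irrefl refl (ℚ.<-≤-trans q<p p≤q))

  U-mono : ∀ {p q} → p ℚ.≤ q → U λ' p → U λ' q
  U-mono {p} {q} p≤q Up with ℚ.<-cmp p q
  ... | tri< p<q _ _ = U-up λ' p<q Up
  ... | tri≈ _ refl _ = Up
  ... | tri> _ _ q<p = ⊥-elim (ℚ.<-irrefl refl (ℚ.<-≤-trans q<p p≤q))

  L<U : ∀ {p q} → L λ' p → U λ' q → p ℚ.< q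
  L<U {p} {q} Lp Uq with p ℚ.<? q
  ... | yes p<q = p<q
  ... | no p≮q = ⊥-elim (disjoint λ' (Lp , U-mono (ℚ.≮⇒≥ p≮q) Uq))

  AffLt-pos : ∀ {m c} → AffLt λ' (+ suc m) c 1ℚ → U λ' ((+ 1 ℤ.- c) / suc m)
  AffLt-pos {m} {c} (_ , q@record{} , _ , Uq , _ , lt) = U-up λ'
    (subst (ℚ._< _) (↥/↧ q) (/-<⁺ (↥ q) _ (+ 1 ℤ.- c) m
      (translate-< (ℤ.- (c ℤ.* ↧ q))
        (solve 3 (λ n m t → n :* m :+ t :+ :- t := n :* m) refl (↥ q) (+ suc m) (c ℤ.* ↧ q))
        (solve 2 (λ c d → con (+ 1) :* d :+ :- (c :* d) := (con (+ 1) :- c) :* d) refl c (↧ q))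
        (affine-<⁻ q (+ suc m) c (+ 1) lt))))
    Uq

  AffLt-neg : ∀ {m c} → AffLt λ' -[1+ m ] c 1ℚ → L λ' ((c ℤ.- + 1) / suc m)
  AffLt-neg {m} {c} (p@record{} , _ , Lp , _ , lt , _) = L-down λ'
    (subst (_ ℚ.<_) (↥/↧ p) (/-<⁺ (c ℤ.- + 1) m (↥ p) _
      (translate-< (↥ p ℤ.* + suc m ℤ.- + 1 ℤ.* ↧ p)
        (solve 4 (λ n m c d → n :* :- m :+ c :* d :+ (n :* m :- con (+ 1) :* d)
                              := (c :- con (+ 1)) :* d) refl (↥ p) (+ suc m) c (↧ p))
        (solve 3 (λ n m t → t :+ (n :* m :- t) := n :* m) refl (↥ p) (+ suc m) (+ 1 ℤ.* ↧ p))
        (affine-<⁻ p -[1+ m ] c (+ 1) lt))))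
    Lp

  -- `U` is open, so it also contains some `r` below the bound; with any `p` in `L` this gives an
  -- enclosure on which the affine expression is negative.
  AffNonneg-pos : ∀ {m c} → AffNonneg λ' (+ suc m) c → ¬ U λ' ((ℤ.- c) / suc m)
  AffNonneg-pos {m} {c} nonneg Uc
    with r , r<c , Ur ← U-rounded λ' Uc | p , Lp ← L-inhabited λ' =
    nonneg (p , r , Lp , Ur , below p (ℚ.<-trans (L<U Lp Ur) r<c) , below r r<c)
    where
    below : ∀ q → q ℚ.< (ℤ.- c) / suc m → q ℚ.* ℤ→ℚ (+ suc m) ℚ.+ ℤ→ℚ c ℚ.< 0ℚ
    below q q<c = affine-<⁺ q (+ suc m) c (+ 0) (translate-< (c ℤ.* ↧ q) refl
      (solve 2 (λ c d → (:- c) :* d :+ c :* d := con (+ 0) :* d) refl c (↧ q)) (/-<⁻ q (ℤ.- c) m q<c))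

  AffNonneg-neg : ∀ {m c} → AffNonneg λ' -[1+ m ] c → ¬ L λ' (c / suc m)
  AffNonneg-neg {m} {c} nonneg Lc
    with r , c<r , Lr ← L-rounded λ' Lc | q , Uq ← U-inhabited λ' =
    nonneg (r , q , Lr , Uq , above r c<r , above q (ℚ.<-trans c<r (L<U Lr Uq)))
    where
    above : ∀ q → c / suc m ℚ.< q → q ℚ.* ℤ→ℚ -[1+ m ] ℚ.+ ℤ→ℚ c ℚ.< 0ℚ
    above q c<q = affine-<⁺ q -[1+ m ] c (+ 0) (translate-< (ℤ.- (↥ q ℤ.* + suc m))
      (solve 4 (λ n m c d → c :* d :+ :- (n :* m) := n :* :- m :+ c :* d) refl (↥ q) (+ suc m) c (↧ q))
      (solve 3 (λ n m d → n :* m :+ :- (n :* m) := con (+ 0) :* d) refl (↥ q) (+ suc m) (↧ q))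
      (/->⁻ q c m c<q))

  AffLt-zero : ∀ {c} → AffLt λ' (+ 0) c 1ℚ → c ℤ.< + 1
  AffLt-zero {c} (_ , q@record{} , _ , _ , _ , lt) = ℤ.*-cancelʳ-<-nonNeg (↧ q)
    (translate-< (+ 0)
      (solve 2 (λ n t → n :* con (+ 0) :+ t :+ con (+ 0) := t) refl (↥ q) (c ℤ.* ↧ q))
      (ℤ.+-identityʳ _) (affine-<⁻ q (+ 0) c (+ 1) lt))

  AffNonneg-zero : ∀ {c} → AffNonneg λ' (+ 0) c → + 0 ℤ.≤ c
  AffNonneg-zero {c} nonneg with p , Lp ← L-inhabited λ' | q , Uq ← U-inhabited λ' =
    ℤ.≮⇒≥ λ c<0 → nonneg (p , q , Lp , Uq , below c<0 p , below c<0 q)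
    where
    below : c ℤ.< + 0 → ∀ q → q ℚ.* ℤ→ℚ (+ 0) ℚ.+ ℤ→ℚ c ℚ.< 0ℚ
    below c<0 q@record{} = affine-<⁺ q (+ 0) c (+ 0) (translate-< (+ 0)
      (solve 2 (λ n t → t :+ con (+ 0) := n :* con (+ 0) :+ t) refl (↥ q) (c ℤ.* ↧ q))
      (ℤ.+-identityʳ _) (ℤ.*-monoʳ-<-pos (↧ q) c<0))

-- The step expressed by a floor or a ceiling.

transpose : ∀ z x {c} → z ℤ.+ x ≡ c → z ≡ c ℤ.- x
transpose z x refl = solve 2 (λ z x → z := z :+ x :- x) refl z x

neg-flip : ∀ i j → ℤ.- (i ℤ.- j) ≡ j ℤ.- i
neg-flip = solve 2 (λ i j → :- (i :- j) := j :- i) refl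

suc-flip : ∀ i j → + 1 ℤ.- (i ℤ.- j) ≡ + 1 ℤ.+ j ℤ.- i
suc-flip = solve 2 (λ i j → con (+ 1) :- (i :- j) := con (+ 1) :+ j :- i) refl

pred-shift : ∀ i j → + 1 ℤ.+ j ℤ.- i ℤ.- + 1 ≡ j ℤ.- i
pred-shift = solve 2 (λ i j → con (+ 1) :+ j :- i :- con (+ 1) := j :- i) refl

-1<⇒ℕ : ∀ {i} → -[1+ 0 ] ℤ.< i → + ∣ i ∣ ≡ i
-1<⇒ℕ lt = ℤ.0≤i⇒+∣i∣≡i (ℤ.i<j⇒suc[i]≤j lt)

-- The hypothesis is -2 < (1 - c)/m with denominators cleared. This is how λ > -2 makes the floor of
-- μm a natural number.
nat-above : ∀ m c → -[1+ 1 ] ℤ.* m ℤ.< (+ 1 ℤ.- c) ℤ.* + 1 → ∃[ g ] c ≡ + 2 ℤ.* m ℤ.- + g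
nat-above m c lt = ∣ k ℤ.- c ∣ , trans
  (solve 2 (λ c k → c := k :- (k :- c)) refl c k)
  (cong (λ t → k ℤ.- t) (sym (-1<⇒ℕ (translate-< (k ℤ.- + 1)
    (solve 1 (λ m → con -[1+ 1 ] :* m :+ (con (+ 2) :* m :- con (+ 1)) := con -[1+ 0 ]) refl m)
    (solve 2 (λ c k → (con (+ 1) :- c) :* con (+ 1) :+ (k :- con (+ 1)) := k :- c) refl c k)
    lt))))
  where k = + 2 ℤ.* m

nat-below : ∀ m c → -[1+ 1 ] ℤ.* m ℤ.< c ℤ.* + 1 → ∃[ g ] c ≡ + suc g ℤ.- + 2 ℤ.* m
nat-below m c lt = ∣ k ℤ.+ c ℤ.- + 1 ∣ , trans
  (solve 2 (λ c k → c := con (+ 1) :+ (k :+ c :- con (+ 1)) :- k) refl c k)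
  (cong (λ t → + 1 ℤ.+ t ℤ.- k) (sym (-1<⇒ℕ (translate-< (k ℤ.- + 1)
    (solve 1 (λ m → con -[1+ 1 ] :* m :+ (con (+ 2) :* m :- con (+ 1)) := con -[1+ 0 ]) refl m)
    (solve 2 (λ c k → c :* con (+ 1) :+ (k :- con (+ 1)) := k :+ c :- con (+ 1)) refl c k)
    lt))))
  where k = + 2 ℤ.* m

module Floor (λ' : ℝ) (-2<λ : L λ' (- (+ 2 / 1))) where

  open Cut λ'

  infix 4 _/1+_<μ μ<_/1+_

  -- A data type rather than a synonym: the rational `frac n d` does not determine `n` and `d`, so
  -- they could not be inferred from it.
  data _/1+_<μ (n d : ℕ) : Set where
    lower : L λ' (frac n d) → n /1+ d <μ

  data μ<_/1+_ (n d : ℕ) : Set where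
    upper : U λ' (frac n d) → μ< n /1+ d

  <μ-down : ∀ {n d n′ d′} → n′ ℕ.* suc d ℕ.≤ n ℕ.* suc d′ → n /1+ d <μ → n′ /1+ d′ <μ
  <μ-down {n} {d} {n′} {d′} le (lower l) = lower (L-mono (frac-mono-≤ {n′} {d′} {n} {d} le) l)

  μ<-up : ∀ {n d n′ d′} → n ℕ.* suc d′ ℕ.≤ n′ ℕ.* suc d → μ< n /1+ d → μ< n′ /1+ d′
  μ<-up {n} {d} {n′} {d′} le (upper u) = upper (U-mono (frac-mono-≤ {n} {d} {n′} {d′} le) u)

  located-μ : ∀ {n d n′ d′} → n ℕ.* suc d′ ℕ.< n′ ℕ.* suc d → n /1+ d <μ ⊎ μ< n′ /1+ d′
  located-μ {n} {d} {n′} {d′} lt = Sum.map lower upper (located λ' (frac-mono-< {n} {d} {n′} {d′} lt))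

  <μ< : ∀ {n d n′ d′} → n /1+ d <μ → μ< n′ /1+ d′ → n ℕ.* suc d′ ℕ.< n′ ℕ.* suc d
  <μ< {n} {d} (lower l) u = ℕ.≰⇒> λ le →
    case μ<-up {n′ = n} {d} le u of λ { (upper u′) → disjoint λ' (l , u′) }

  ≤μ< : ∀ {n d n′ d′} → ¬ μ< n /1+ d → μ< n′ /1+ d′ → n ℕ.* suc d′ ℕ.< n′ ℕ.* suc d
  ≤μ< l u = ℕ.≰⇒> λ le → l (μ<-up le u)

  <μ≤ : ∀ {n d n′ d′} → n /1+ d <μ → ¬ n′ /1+ d′ <μ → n ℕ.* suc d′ ℕ.< n′ ℕ.* suc d
  <μ≤ l u = ℕ.≰⇒> λ le → u (<μ-down le l)

  -- Were the bounds in the wrong order, locating μ between them would contradict one of the two.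
  ≤μ≤ : ∀ {n d n′ d′} → ¬ μ< n /1+ d → ¬ n′ /1+ d′ <μ → n ℕ.* suc d′ ℕ.≤ n′ ℕ.* suc d
  ≤μ≤ l u = ℕ.≮⇒≥ λ lt → [ u , l ]′ (located-μ lt)

  -- The step from x and y = ±(m + 1) to z, where g = ⌊μ(m + 1)⌋ in Floor⁺ (y > 0) and
  -- g + 1 = ⌈μ(m + 1)⌉ in Floor⁻ (y < 0).
  Floor⁺ Floor⁻ : ℤ → ℕ → ℤ → ℕ → Set
  Floor⁺ x m z g = z ≡ (2 ℕ.* suc m ⊖ g) ℤ.- x × ¬ μ< g /1+ m × μ< suc g /1+ m
  Floor⁻ x m z g = z ≡ (suc g ⊖ 2 ℕ.* suc m) ℤ.- x × g /1+ m <μ × ¬ suc g /1+ m <μ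

  -- For y = m + 1 and z + x = 2y - g, the condition 0 ≤ λy + z + x < 1 reads g ≤ μy < g + 1.
  floor⁺ : ∀ {x m z} → Step λ' x (+ suc m) z → ∃[ g ] Floor⁺ x m z g
  floor⁺ {x} {m} {z} (nonneg , lt) = witness
    (nat-above (+ suc m) c (/-<⁻ (- (+ 2 / 1)) (+ 1 ℤ.- c) m (L<U -2<λ Uc)))
    where
    c = z ℤ.+ x
    Uc = AffLt-pos {m} {c} lt
    witness : ∃[ g ] c ≡ + (2 ℕ.* suc m) ℤ.- + g → ∃[ g ] Floor⁺ x m z g
    witness (g , c≡) = g
      , trans (transpose z x c≡) (cong (ℤ._- x) (ℤ.m-n≡m⊖n (2 ℕ.* suc m) g))
      , (λ { (upper u) → AffNonneg-pos {m} {c} nonneg (subst (λ t → U λ' (t / suc m))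
               (sym (trans (cong ℤ.-_ c≡) (neg-flip (+ (2 ℕ.* suc m)) (+ g)))) u) })
      , upper (subst (λ t → U λ' (t / suc m))
          (trans (cong (λ t → + 1 ℤ.- t) c≡) (suc-flip (+ (2 ℕ.* suc m)) (+ g))) Uc)

  floor⁻ : ∀ {x m z} → Step λ' x -[1+ m ] z → ∃[ g ] Floor⁻ x m z g
  floor⁻ {x} {m} {z} (nonneg , lt) = witness
    (nat-below (+ suc m) c (ℤ.≰⇒> λ le → Lc (L-mono (/-≤⁺ c m -[1+ 1 ] 0 le) -2<λ)))
    where
    c = z ℤ.+ x
    Lc = AffNonneg-neg {m} {c} nonneg
    witness : ∃[ g ] c ≡ + suc g ℤ.- + (2 ℕ.* suc m) → ∃[ g ] Floor⁻ x m z g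
    witness (g , c≡) = g
      , trans (transpose z x c≡) (cong (ℤ._- x) (ℤ.m-n≡m⊖n (suc g) (2 ℕ.* suc m)))
      , lower (subst (λ t → L λ' (t / suc m))
          (trans (cong (ℤ._- + 1) c≡) (pred-shift (+ (2 ℕ.* suc m)) (+ g))) (AffLt-neg {m} {c} lt))
      , (λ { (lower l) → Lc (subst (λ t → L λ' (t / suc m)) (sym c≡) l) })

  step-zero : ∀ {x z} → Step λ' x (+ 0) z → z ≡ ℤ.- x
  step-zero {x} {z} (nonneg , lt) = trans
    (transpose z x z+x≡0) (ℤ.+-identityˡ (ℤ.- x))
    where
    z+x≡0 : z ℤ.+ x ≡ + 0
    z+x≡0 = ℤ.≤-antisym (ℤ.i<j⇒i≤pred[j] (AffLt-zero {z ℤ.+ x} lt)) (AffNonneg-zero {z ℤ.+ x} nonneg)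

  floor⁺-≤ : ∀ {m g g′} → ¬ μ< g /1+ m → μ< suc g′ /1+ m → g ℕ.≤ g′
  floor⁺-≤ {m} {g} {g′} lo up = ℕ.s≤s⁻¹ (ℕ.*-cancelʳ-< (suc m) g (suc g′) (≤μ< lo up))

  floor⁻-≤ : ∀ {m g g′} → g /1+ m <μ → ¬ suc g′ /1+ m <μ → g ℕ.≤ g′
  floor⁻-≤ {m} {g} {g′} lo up = ℕ.s≤s⁻¹ (ℕ.*-cancelʳ-< (suc m) g (suc g′) (<μ≤ lo up))

  Floor⁺-unique : ∀ {x m z z′} → ∃[ g ] Floor⁺ x m z g → ∃[ g ] Floor⁺ x m z′ g → z ≡ z′
  Floor⁺-unique {x} {m} (g , z≡ , lo , up) (g′ , z′≡ , lo′ , up′) =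
    trans z≡ (trans (cong (λ g → (2 ℕ.* suc m ⊖ g) ℤ.- x) g≡g′) (sym z′≡))
    where g≡g′ = ℕ.≤-antisym (floor⁺-≤ lo up′) (floor⁺-≤ lo′ up)

  Floor⁻-unique : ∀ {x m z z′} → ∃[ g ] Floor⁻ x m z g → ∃[ g ] Floor⁻ x m z′ g → z ≡ z′
  Floor⁻-unique {x} {m} (g , z≡ , lo , up) (g′ , z′≡ , lo′ , up′) =
    trans z≡ (trans (cong (λ g → (suc g ⊖ 2 ℕ.* suc m) ℤ.- x) g≡g′) (sym z′≡))
    where g≡g′ = ℕ.≤-antisym (floor⁻-≤ lo up′) (floor⁻-≤ lo′ up)

  -- Together with `Step-sym` this gives injectivity of the dynamics as well as determinism.
  step-unique : ∀ {x y z z′} → Step λ' x y z → Step λ' x y z′ → z ≡ z′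
  step-unique {x} {+ zero} {z} {z′} s s′ = trans (step-zero {x} {z} s) (sym (step-zero {x} {z′} s′))
  step-unique {x} {+ suc m} {z} {z′} s s′ = Floor⁺-unique (floor⁺ {x} {m} {z} s) (floor⁺ {x} {m} {z′} s′)
  step-unique {x} { -[1+ m ]} {z} {z′} s s′ = Floor⁻-unique (floor⁻ {x} {m} {z} s) (floor⁻ {x} {m} {z′} s′)

-- The search over intervals of μ.

infix 4 _==_
_==_ : ℤ → ℤ → Bool
+ m == + n = m ℕ.≡ᵇ n
-[1+ m ] == -[1+ n ] = m ℕ.≡ᵇ n
_ == _ = false

==⇒≡ : ∀ i j → T (i == j) → i ≡ j
==⇒≡ (+ m) (+ n) t = cong +_ (ℕ.≡ᵇ⇒≡ m n t)
==⇒≡ -[1+ m ] -[1+ n ] t = cong -[1+_] (ℕ.≡ᵇ⇒≡ m n t)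

Box : ℤ → ℤ → Set
Box x y = ∣ x ∣ ≤ 10 × ∣ y ∣ ≤ 10

inBox : ℤ → ℤ → Bool
inBox x y = (∣ x ∣ ℕ.<ᵇ 11) ∧ (∣ y ∣ ℕ.<ᵇ 11)

inBox⇒Box : ∀ x y → T (inBox x y) → Box x y
inBox⇒Box x y t with t₁ , t₂ ← Equivalence.to T-∧ t =
  ℕ.s≤s⁻¹ (ℕ.<ᵇ⇒< ∣ x ∣ 11 t₁) , ℕ.s≤s⁻¹ (ℕ.<ᵇ⇒< ∣ y ∣ 11 t₂)

-- The interval from ln / (1 + ld) to un / (1 + ud) on the axis of μ.  The flags are
-- 0 or 1: cl = 1 means closed on the left, but su = 1 means open on the right.
record Interval : Set where
  constructor interval
  field ln ld cl un ud su : ℕ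

-- run f x y i tests that for all μ in i the orbit of (x, y) meets the box or a reflection, with
-- fuel f.  For y = ±(m + 1), run⁺ and run⁻ go through the values that g can take for μ in i,
-- in increasing order, and cut i at the points (g + 1) / (m + 1) between them.
run : ℕ → ℤ → ℤ → Interval → Bool
run⁺ run⁻ : ℕ → ℤ → ℕ → ℕ → Interval → Bool
arrive : ℕ → ℤ → ℤ → ℤ → Interval → Bool

run zero x y i = false
run (suc f) x (+ zero) i = arrive f x (+ zero) (ℤ.- x) i
run (suc f) x (+ suc m) i@(interval ln ld cl un ud su) = run⁺ f x m ((ln ℕ.* suc m) ℕ./ suc ld) i
-- Here g + 1 is a ceiling: if the left end is attained and its multiple is an integer, `g` is one
-- less than that integer, hence the subtraction of `cl`.
run (suc f) x -[1+ m ] i@(interval ln ld cl un ud su) = run⁻ f x m ((ln ℕ.* suc m ℕ.∸ cl) ℕ./ suc ld) i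

run⁺ zero x m g i = false
run⁺ (suc f) x m g i@(interval ln ld cl un ud su) =
  -- The test says that every μ in `i` is below (g + 1)/(m + 1); an open right end may equal this
  -- point.
  if un ℕ.* suc m ℕ.<ᵇ (1 ℕ.+ g) ℕ.* suc ud ℕ.+ su
  then arrive f x (+ suc m) ((2 ℕ.* suc m ⊖ g) ℤ.- x) i
  else arrive f x (+ suc m) ((2 ℕ.* suc m ⊖ g) ℤ.- x) (interval ln ld cl (1 ℕ.+ g) m 1)
     ∧ run⁺ f x m (1 ℕ.+ g) (interval (1 ℕ.+ g) m 1 un ud su)

run⁻ zero x m g i = false
run⁻ (suc f) x m g i@(interval ln ld cl un ud su) =
  -- The ceiling is still g + 1 at (g + 1)/(m + 1), so the right end may equal this point even if
  -- attained, and the cut point goes to the left piece.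
  if un ℕ.* suc m ℕ.<ᵇ (1 ℕ.+ g) ℕ.* suc ud ℕ.+ 1
  then arrive f x -[1+ m ] ((1 ℕ.+ g ⊖ 2 ℕ.* suc m) ℤ.- x) i
  else arrive f x -[1+ m ] ((1 ℕ.+ g ⊖ 2 ℕ.* suc m) ℤ.- x) (interval ln ld cl (1 ℕ.+ g) m 0)
     ∧ run⁻ f x m (1 ℕ.+ g) (interval (1 ℕ.+ g) m 0 un ud su)

arrive f x y z i = inBox y z ∨ ((z == x) ∨ ((z == y) ∨ run f y z i))

if-cases : ∀ b {s t} → T (if b then s else t) → (T b × T s) ⊎ T t
if-cases true  p = inj₁ (_ , p)
if-cases false p = inj₂ p

all< : ℕ → (ℕ → Bool) → Bool
all< zero    p = true
all< (suc n) p = p n ∧ all< n p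

all<-sound : ∀ n p {k} → k ℕ.< n → T (all< n p) → T (p k)
all<-sound (suc n) p k<1+n t with ℕ.m≤n⇒m<n∨m≡n (ℕ.s≤s⁻¹ k<1+n)
... | inj₁ k<n  = all<-sound n p k<n (proj₂ (Equivalence.to T-∧ t))
... | inj₂ refl = proj₁ (Equivalence.to T-∧ t)

all∣∣≤10 : (ℤ → Bool) → Bool
all∣∣≤10 p = all< 11 (λ k → p (+ k)) ∧ all< 10 (λ k → p -[1+ k ])

all∣∣≤10-sound : ∀ p i → ∣ i ∣ ≤ 10 → T (all∣∣≤10 p) → T (p i)
all∣∣≤10-sound p (+ k)    k≤10 t = all<-sound 11 (λ k → p (+ k)) (ℕ.s≤s k≤10) (proj₁ (Equivalence.to T-∧ t))
all∣∣≤10-sound p -[1+ k ] k<10 t =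
  all<-sound 10 (λ k → p -[1+ k ]) k<10 (proj₂ (Equivalence.to (T-∧ {all< 11 (λ k → p (+ k))}) t))

allBox : (ℤ → ℤ → Bool) → Bool
allBox p = all∣∣≤10 λ x → all∣∣≤10 λ y → p x y

allBox-sound : ∀ p → allBox p ≡ true → ∀ x y → Box x y → T (p x y)
allBox-sound p e x y (b₀ , b₁) = all∣∣≤10-sound (p x) y b₁
  (all∣∣≤10-sound (λ x → all∣∣≤10 (p x)) x b₀ (Equivalence.from T-≡ e))

-- The intervals overlap between 1/230 and 1/229, since a real can only be located relative to two
-- distinct rationals. The ends 0 and 4 are λ = -2 and λ = 2.
far near : Interval
far  = interval 1 229 0 4 0 1
near = interval 0 0 0 1 228 1

-- From these pairs the orbit can rise until it passes 1/μ, so no fixed fuel covers all small μ.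
climbs : ℤ → ℤ → Bool
climbs (+ _) (+ suc _) = true
climbs _     _         = false

farCheck nearCheck : ℤ → ℤ → Bool
-- Fuel is spent on cuts as well as on steps; 2000 suffices for every pair.
farCheck  x y = run 2000 x y far
nearCheck x y = climbs y (y ℤ.- x) ∨ run 2000 x y near

far-checked : allBox farCheck ≡ true
far-checked = refl

near-checked : allBox nearCheck ≡ true
near-checked = refl

-- Triangular numbers and the recurrence along a climb.

triangle : ℕ → ℕ
triangle zero    = 0
triangle (suc d) = d ℕ.+ triangle d

triangle-mono : ∀ {d e} → d ℕ.≤ e → triangle d ℕ.≤ triangle e
triangle-mono ℕ.z≤n       = ℕ.z≤n
triangle-mono (ℕ.s≤s d≤e) = ℕ.+-mono-≤ d≤e (triangle-mono d≤e)

crest-ring : ∀ w d → + 2 ℤ.* w ℤ.- + 1 ℤ.- (w ℤ.- (+ 1 ℤ.+ d)) ≡ w ℤ.+ d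
crest-ring = solve 2 (λ w d → con (+ 2) :* w :- con (+ 1) :- (w :- (con (+ 1) :+ d)) := w :+ d) refl

slope-ring : ∀ w d → + 2 ℤ.* w ℤ.- + 0 ℤ.- (w ℤ.- d) ≡ w ℤ.+ d
slope-ring = solve 2 (λ w d → con (+ 2) :* w :- con (+ 0) :- (w :- d) := w :+ d) refl

cancel-ring : ∀ w d → w ≡ w ℤ.+ d ℤ.- d
cancel-ring = solve 2 (λ w d → w := w :+ d :- d) refl

-- Numbering the pairs of the box.

code : ℤ → ℕ
code (+ k)    = k
code -[1+ k ] = 11 ℕ.+ k

code-< : ∀ i → ∣ i ∣ ≤ 10 → code i ℕ.< 21
code-< (+ k)    k≤10 = ℕ.≤-trans (ℕ.s≤s k≤10) (ℕ.m≤m+n 11 10)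
code-< -[1+ k ] k<10 = ℕ.+-monoʳ-≤ 11 k<10

code-injective : ∀ i j → ∣ i ∣ ≤ 10 → ∣ j ∣ ≤ 10 → code i ≡ code j → i ≡ j
code-injective (+ k)    (+ l)    _ _ e = cong +_ e
code-injective -[1+ k ] -[1+ l ] _ _ e = cong -[1+_] (ℕ.+-cancelˡ-≡ 11 k l e)
code-injective (+ k)    -[1+ l ] k≤10 _ e = ⊥-elim
  (ℕ.<⇒≱ (ℕ.s≤s k≤10) (ℕ.≤-trans (ℕ.m≤m+n 11 l) (ℕ.≤-reflexive (sym e))))
code-injective -[1+ k ] (+ l)    _ l≤10 e = ⊥-elim
  (ℕ.<⇒≱ (ℕ.s≤s l≤10) (ℕ.≤-trans (ℕ.m≤m+n 11 k) (ℕ.≤-reflexive e)))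

encode : ∀ x y → Box x y → Fin (21 ℕ.* 21)
encode x y (b₀ , b₁) = combine (fromℕ< (code-< x b₀)) (fromℕ< (code-< y b₁))

encode-injective : ∀ {x y x′ y′} (b : Box x y) (b′ : Box x′ y′) →
  encode x y b ≡ encode x′ y′ b′ → x ≡ x′ × y ≡ y′
encode-injective {x} {y} {x′} {y′} (b₀ , b₁) (b₀′ , b₁′) e =
  code-injective x x′ b₀ b₀′ (Fin.fromℕ<-injective (code x) (code x′) _ _
    (Fin.combine-injectiveˡ i j i′ j′ e)) ,
  code-injective y y′ b₁ b₁′ (Fin.fromℕ<-injective (code y) (code y′) _ _
    (Fin.combine-injectiveʳ i j i′ j′ e))
  where
  i  = fromℕ< (code-< x b₀)
  j  = fromℕ< (code-< y b₁)
  i′ = fromℕ< (code-< x′ b₀′)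
  j′ = fromℕ< (code-< y′ b₁′)

-- Determinism, reversal and reflection of the orbit.

module Orbit (λ' : ℝ) (-2<λ : L λ' (- (+ 2 / 1))) (a : ℕ → ℤ) (srs : SRS λ' a) where

  open Cut λ' using (L-mono)
  open Floor λ' -2<λ

  step-forward : ∀ i j → a i ≡ a j → a (suc i) ≡ a (suc j) → a (2 ℕ.+ i) ≡ a (2 ℕ.+ j)
  step-forward i j e₀ e₁ = step-unique {a i} {a (suc i)} {a (2 ℕ.+ i)} {a (2 ℕ.+ j)} (srs i)
    (subst₂ (λ x y → Step λ' x y (a (2 ℕ.+ j))) (sym e₀) (sym e₁) (srs j))

  step-mirror : ∀ i j → a i ≡ a (2 ℕ.+ j) → a (suc i) ≡ a (suc j) → a (2 ℕ.+ i) ≡ a j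
  step-mirror i j e₀ e₁ = step-unique {a i} {a (suc i)} {a (2 ℕ.+ i)} {a j} (srs i)
    (subst₂ (λ x y → Step λ' x y (a j)) (sym e₀) (sym e₁)
      (Step-sym {λ'} {a j} {a (suc j)} {a (2 ℕ.+ j)} (srs j)))

  step-backward : ∀ i j → a (suc i) ≡ a (suc j) → a (2 ℕ.+ i) ≡ a (2 ℕ.+ j) → a i ≡ a j
  step-backward i j e₁ e₂ = step-unique {a (2 ℕ.+ i)} {a (suc i)} {a i} {a j}
    (Step-sym {λ'} {a i} {a (suc i)} {a (2 ℕ.+ i)} (srs i))
    (subst₂ (λ z y → Step λ' z y (a j)) (sym e₂) (sym e₁)
      (Step-sym {λ'} {a j} {a (suc j)} {a (2 ℕ.+ j)} (srs j)))

  Visits : ℕ → Set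
  Visits n = Box (a n) (a (suc n))

  Returns : ℕ → Set
  Returns n = ∃[ s ] n ℕ.< s × Visits s

  -- From `s` on the orbit retraces its earlier terms, one index per use of `step-mirror`; after `k`
  -- steps it stands at the swapped pair of the visit at `n`.
  mirror-returns : ∀ {n} → Visits n → ∀ k s → n ℕ.< s →
    a s ≡ a (suc (k ℕ.+ n)) → a (suc s) ≡ a (k ℕ.+ n) → Returns n
  mirror-returns (b₀ , b₁) zero s n<s e₀ e₁ =
    s , n<s , subst (λ t → ∣ t ∣ ≤ 10) (sym e₀) b₁ , subst (λ t → ∣ t ∣ ≤ 10) (sym e₁) b₀
  mirror-returns {n} b (suc k) s n<s e₀ e₁ =
    mirror-returns b k (suc s) (ℕ.m<n⇒m<1+n n<s) e₁ (step-mirror s (k ℕ.+ n) e₀ e₁)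

  -- Soundness of the search.

  Lower Upper : ℕ → ℕ → ℕ → Set
  Lower n d 0 = n /1+ d <μ
  Lower n d 1 = ¬ μ< n /1+ d
  -- Flags above 1 describe no interval, which rules out their cases below.
  Lower _ _ _ = ⊥
  Upper n d 0 = ¬ n /1+ d <μ
  Upper n d 1 = μ< n /1+ d
  Upper _ _ _ = ⊥

  μ∈_ : Interval → Set
  μ∈ interval ln ld cl un ud su = Lower ln ld cl × Upper un ud su

  start⁺ : ∀ {ln ld m g} cl → Lower ln ld cl → μ< suc g /1+ m → (ln ℕ.* suc m) ℕ./ suc ld ℕ.≤ g
  start⁺ 0 lo up = ℕ.s≤s⁻¹ (m<n*o⇒m/o<n (<μ< lo up))
  start⁺ 1 lo up = ℕ.s≤s⁻¹ (m<n*o⇒m/o<n (≤μ< lo up))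

  start⁻ : ∀ {ln ld m g} cl → Lower ln ld cl → ¬ suc g /1+ m <μ →
    (ln ℕ.* suc m ℕ.∸ cl) ℕ./ suc ld ℕ.≤ g
  start⁻ 0 lo up = ℕ.s≤s⁻¹ (m<n*o⇒m/o<n (<μ≤ lo up))
  start⁻ {ln} {ld} {m} {g} 1 lo up = ℕ.s≤s⁻¹ (m<n*o⇒m/o<n (ℕ.s≤s (ℕ.∸-monoˡ-≤ 1 (≤μ≤ lo up))))

  last⁺ : ∀ {un ud m g g′} su → Upper un ud su →
    un ℕ.* suc m ℕ.< suc g ℕ.* suc ud ℕ.+ su → ¬ μ< g′ /1+ m → g′ ℕ.≤ g
  last⁺ {un} {ud} {m} {g} {g′} su up lt lo = ℕ.≮⇒≥ λ g<g′ →
    ℕ.<⇒≱ lt (ℕ.≤-trans (ℕ.+-monoˡ-≤ su (ℕ.*-monoˡ-≤ (suc ud) g<g′)) (bound su up))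
    where
    bound : ∀ su → Upper un ud su → g′ ℕ.* suc ud ℕ.+ su ℕ.≤ un ℕ.* suc m
    bound 0 up = subst (ℕ._≤ un ℕ.* suc m) (sym (ℕ.+-identityʳ _)) (≤μ≤ lo up)
    bound 1 up = subst (ℕ._≤ un ℕ.* suc m) (ℕ.+-comm 1 _) (≤μ< lo up)

  last⁻ : ∀ {un ud m g g′} su → Upper un ud su →
    un ℕ.* suc m ℕ.< suc g ℕ.* suc ud ℕ.+ 1 → g′ /1+ m <μ → g′ ℕ.≤ g
  last⁻ {un} {ud} {m} {g} {g′} su up lt lo = ℕ.≮⇒≥ λ g<g′ →
    ℕ.<⇒≱ lt (subst (ℕ._≤ un ℕ.* suc m) (ℕ.+-comm 1 _)
      (ℕ.<-≤-trans (ℕ.s≤s (ℕ.*-monoˡ-≤ (suc ud) g<g′)) (bound su up)))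
    where
    bound : ∀ su → Upper un ud su → g′ ℕ.* suc ud ℕ.< un ℕ.* suc m
    bound 0 up = <μ≤ lo up
    bound 1 up = <μ< lo up

  module Soundness (n : ℕ) (visits : Visits n) where

    run-sound : ∀ f k y i → a (suc (k ℕ.+ n)) ≡ y → μ∈ i → T (run f (a (k ℕ.+ n)) y i) → Returns n
    -- Which side of a cut contains μ is settled by comparing the candidate `g` with the true value
    -- `g′`: an exact distinction between naturals, although μ is real.
    run⁺-sound : ∀ f k m g i → a (suc (k ℕ.+ n)) ≡ + suc m → μ∈ i →
      ∀ g′ → Floor⁺ (a (k ℕ.+ n)) m (a (2 ℕ.+ (k ℕ.+ n))) g′ → g ℕ.≤ g′ →
      T (run⁺ f (a (k ℕ.+ n)) m g i) → Returns n
    run⁻-sound : ∀ f k m g i → a (suc (k ℕ.+ n)) ≡ -[1+ m ] → μ∈ i →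
      ∀ g′ → Floor⁻ (a (k ℕ.+ n)) m (a (2 ℕ.+ (k ℕ.+ n))) g′ → g ℕ.≤ g′ →
      T (run⁻ f (a (k ℕ.+ n)) m g i) → Returns n
    arrive-sound : ∀ f k y z i → a (suc (k ℕ.+ n)) ≡ y → a (2 ℕ.+ (k ℕ.+ n)) ≡ z → μ∈ i →
      T (arrive f (a (k ℕ.+ n)) y z i) → Returns n

    run-sound (suc f) k (+ zero) i y≡ ∈i t =
      arrive-sound f k (+ zero) (ℤ.- a (k ℕ.+ n)) i y≡
        (step-zero {a (k ℕ.+ n)} {a (2 ℕ.+ (k ℕ.+ n))}
          (subst (λ y → Step λ' (a (k ℕ.+ n)) y (a (2 ℕ.+ (k ℕ.+ n)))) y≡ (srs (k ℕ.+ n))))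
        ∈i t
    run-sound (suc f) k (+ suc m) i@(interval ln ld cl un ud su) y≡ ∈i t =
      enter (floor⁺ {a (k ℕ.+ n)} {m} {a (2 ℕ.+ (k ℕ.+ n))}
        (subst (λ y → Step λ' (a (k ℕ.+ n)) y (a (2 ℕ.+ (k ℕ.+ n)))) y≡ (srs (k ℕ.+ n))))
      where
      enter : ∃[ g ] Floor⁺ (a (k ℕ.+ n)) m (a (2 ℕ.+ (k ℕ.+ n))) g → Returns n
      enter (g , fl@(_ , _ , up)) =
        run⁺-sound f k m ((ln ℕ.* suc m) ℕ./ suc ld) i y≡ ∈i g fl (start⁺ cl (proj₁ ∈i) up) t
    run-sound (suc f) k -[1+ m ] i@(interval ln ld cl un ud su) y≡ ∈i t =
      enter (floor⁻ {a (k ℕ.+ n)} {m} {a (2 ℕ.+ (k ℕ.+ n))}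
        (subst (λ y → Step λ' (a (k ℕ.+ n)) y (a (2 ℕ.+ (k ℕ.+ n)))) y≡ (srs (k ℕ.+ n))))
      where
      enter : ∃[ g ] Floor⁻ (a (k ℕ.+ n)) m (a (2 ℕ.+ (k ℕ.+ n))) g → Returns n
      enter (g , fl@(_ , _ , up)) =
        run⁻-sound f k m ((ln ℕ.* suc m ℕ.∸ cl) ℕ./ suc ld) i y≡ ∈i g fl (start⁻ cl (proj₁ ∈i) up) t

    run⁺-sound (suc f) k m g i@(interval ln ld cl un ud su) y≡ ∈i g′ (z≡ , lo , up) g≤g′ t =
      [ whole , split (ℕ.m≤n⇒m<n∨m≡n g≤g′) ]′ (if-cases (un ℕ.* suc m ℕ.<ᵇ suc g ℕ.* suc ud ℕ.+ su) t)
      where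
      x = a (k ℕ.+ n)
      z = (2 ℕ.* suc m ⊖ g) ℤ.- x
      z≡g : g ≡ g′ → a (2 ℕ.+ (k ℕ.+ n)) ≡ z
      z≡g e = trans z≡ (cong (λ g → (2 ℕ.* suc m ⊖ g) ℤ.- x) (sym e))
      whole : T (un ℕ.* suc m ℕ.<ᵇ suc g ℕ.* suc ud ℕ.+ su) × T (arrive f x (+ suc m) z i) → Returns n
      whole (t₁ , t₂) = arrive-sound f k (+ suc m) z i y≡
        (z≡g (ℕ.≤-antisym g≤g′ (last⁺ su (proj₂ ∈i) (ℕ.<ᵇ⇒< (un ℕ.* suc m) _ t₁) lo))) ∈i t₂
      split : g ℕ.< g′ ⊎ g ≡ g′ →
        T (arrive f x (+ suc m) z (interval ln ld cl (suc g) m 1)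
           ∧ run⁺ f x m (suc g) (interval (suc g) m 1 un ud su)) → Returns n
      split (inj₁ g<g′) t = run⁺-sound f k m (suc g) (interval (suc g) m 1 un ud su) y≡
        ((λ u → lo (μ<-up (ℕ.*-monoˡ-≤ (suc m) g<g′) u)) , proj₂ ∈i) g′ (z≡ , lo , up) g<g′
        (proj₂ (Equivalence.to T-∧ t))
      split (inj₂ e) t = arrive-sound f k (+ suc m) z (interval ln ld cl (suc g) m 1) y≡ (z≡g e)
        (proj₁ ∈i , subst (λ g → μ< suc g /1+ m) (sym e) up) (proj₁ (Equivalence.to T-∧ t))

    run⁻-sound (suc f) k m g i@(interval ln ld cl un ud su) y≡ ∈i g′ (z≡ , lo , up) g≤g′ t =
      [ whole , split (ℕ.m≤n⇒m<n∨m≡n g≤g′) ]′ (if-cases (un ℕ.* suc m ℕ.<ᵇ suc g ℕ.* suc ud ℕ.+ 1) t)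
      where
      x = a (k ℕ.+ n)
      z = (suc g ⊖ 2 ℕ.* suc m) ℤ.- x
      z≡g : g ≡ g′ → a (2 ℕ.+ (k ℕ.+ n)) ≡ z
      z≡g e = trans z≡ (cong (λ g → (suc g ⊖ 2 ℕ.* suc m) ℤ.- x) (sym e))
      whole : T (un ℕ.* suc m ℕ.<ᵇ suc g ℕ.* suc ud ℕ.+ 1) × T (arrive f x -[1+ m ] z i) → Returns n
      whole (t₁ , t₂) = arrive-sound f k -[1+ m ] z i y≡
        (z≡g (ℕ.≤-antisym g≤g′ (last⁻ su (proj₂ ∈i) (ℕ.<ᵇ⇒< (un ℕ.* suc m) _ t₁) lo))) ∈i t₂
      split : g ℕ.< g′ ⊎ g ≡ g′ →
        T (arrive f x -[1+ m ] z (interval ln ld cl (suc g) m 0)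
           ∧ run⁻ f x m (suc g) (interval (suc g) m 0 un ud su)) → Returns n
      split (inj₁ g<g′) t = run⁻-sound f k m (suc g) (interval (suc g) m 0 un ud su) y≡
        (<μ-down (ℕ.*-monoˡ-≤ (suc m) g<g′) lo , proj₂ ∈i) g′ (z≡ , lo , up) g<g′
        (proj₂ (Equivalence.to T-∧ t))
      split (inj₂ e) t = arrive-sound f k -[1+ m ] z (interval ln ld cl (suc g) m 0) y≡ (z≡g e)
        (proj₁ ∈i , subst (λ g → ¬ suc g /1+ m <μ) (sym e) up) (proj₁ (Equivalence.to T-∧ t))

    arrive-sound f k y z i refl refl ∈i t =
      [ (λ t → suc (k ℕ.+ n) , n<s , inBox⇒Box y z t)
      -- If z = x, the orbit is reflected in the term y; if z = y, midway between these two equal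
      -- terms. Hence `k` here and `suc k` on the next line.
      , [ (λ t → mirror-returns visits k (suc (k ℕ.+ n)) n<s refl (==⇒≡ z (a (k ℕ.+ n)) t))
        , [ (λ t → mirror-returns visits (suc k) (suc (k ℕ.+ n)) n<s (sym (==⇒≡ z y t)) (==⇒≡ z y t))
          , run-sound f (suc k) z i refl ∈i
          ]′ ∘ Equivalence.to T-∨
        ]′ ∘ Equivalence.to T-∨
      ]′ (Equivalence.to T-∨ t)
      where
      n<s : n ℕ.< suc (k ℕ.+ n)
      n<s = ℕ.s≤s (ℕ.m≤n+m n k)

  -- Climbing orbits for small μ.

  Plateau : ℕ → Set
  Plateau i = ∃[ j ] i ℕ.< j × a j ≡ a (suc j)

  later : ∀ {i} → Plateau (suc i) → Plateau i
  later (j , i<j , e) = j , ℕ.<⇒≤ i<j , e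

  floorAt : ∀ i w → a (suc i) ≡ + suc w → ∃[ g ] Floor⁺ (a i) w (a (2 ℕ.+ i)) g
  floorAt i w e = floor⁺ {a i} {w} {a (2 ℕ.+ i)} (subst (λ y → Step λ' (a i) y (a (2 ℕ.+ i))) e (srs i))

  -- From 1/μ on and below 2/μ the floor is 1, so each step lowers the slope by 1. The rise still to
  -- come is `triangle (suc d)`, so the bound 2(B + 1) < 2/μ holds until the slope is 0.
  crest : ∀ d i w B → a i ≡ + suc w ℤ.- + suc d → a (suc i) ≡ + suc w →
    ¬ μ< 1 /1+ w → μ< 1 /1+ B → suc w ℕ.+ triangle (suc d) ℕ.≤ 2 ℕ.* suc B → Plateau i
  crest d i w B e₀ e₁ lo up w≤2B = go d e₀ w≤2B (floorAt i w e₁)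
    where
    go : ∀ d → a i ≡ + suc w ℤ.- + suc d → suc w ℕ.+ triangle (suc d) ℕ.≤ 2 ℕ.* suc B →
      ∃[ g ] Floor⁺ (a i) w (a (2 ℕ.+ i)) g → Plateau i
    go d e₀ w≤2B (g , z≡ , lo′ , up′) = continue d e₀ w≤2B e₂
      where
      g≡1 : g ≡ 1
      g≡1 = ℕ.≤-antisym
        (ℕ.s≤s⁻¹ (ℕ.*-cancelʳ-< (suc B) g 2 (ℕ.<-≤-trans (≤μ< lo′ up)
          (ℕ.≤-trans (ℕ.≤-reflexive (ℕ.*-identityˡ (suc w))) (ℕ.m+n≤o⇒m≤o (suc w) w≤2B)))))
        (floor⁺-≤ lo up′)
      e₂ : a (2 ℕ.+ i) ≡ + (suc w ℕ.+ d)
      e₂ = trans z≡ (trans (cong₂ (λ g x → (2 ℕ.* suc w ⊖ g) ℤ.- x) g≡1 e₀)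
        (trans (cong (ℤ._- (+ suc w ℤ.- + suc d)) (sym (ℤ.m-n≡m⊖n (2 ℕ.* suc w) 1)))
          (crest-ring (+ suc w) (+ d))))
      continue : ∀ d → a i ≡ + suc w ℤ.- + suc d → suc w ℕ.+ triangle (suc d) ℕ.≤ 2 ℕ.* suc B →
        a (2 ℕ.+ i) ≡ + (suc w ℕ.+ d) → Plateau i
      continue zero e₀ w≤2B e₂ = suc i , ℕ.≤-refl , trans e₁ (sym (trans e₂ (cong +_ (ℕ.+-identityʳ (suc w)))))
      continue (suc d) e₀ w≤2B e₂ = later (crest d (suc i) (w ℕ.+ suc d) B
        (trans e₁ (cancel-ring (+ suc w) (+ suc d))) e₂
        (λ u → lo (μ<-up (ℕ.*-monoʳ-≤ 1 (ℕ.s≤s (ℕ.m≤m+n w (suc d)))) u)) up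
        (ℕ.≤-trans (ℕ.≤-reflexive (ℕ.+-assoc (suc w) (suc d) (triangle (suc d)))) w≤2B))

  -- B + 1 is below 1/μ and not far from the current value w; with 1/μ > 229 this keeps μw below 2
  -- until the slope has decreased to 0.  J + 1 is above 1/μ and bounds the length of the climb.
  climb : ∀ f i w d B J → a i ≡ + w ℤ.- + suc d → a (suc i) ≡ + w → suc d ℕ.≤ 20 →
    210 ℕ.≤ suc B → μ< 1 /1+ B → w ℕ.≤ suc B ℕ.+ suc d →
    1 /1+ J <μ → suc J ℕ.≤ w ℕ.+ f → Plateau i
  -- At 0 the step is negation, which keeps the slope.
  climb (suc f) i zero d B J e₀ e₁ d≤20 210≤B up w≤ lo J≤ = later
    (climb f (suc i) (suc d) d B J (trans e₁ (cancel-ring (+ 0) (+ suc d)))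
      (trans (step-zero {a i} {a (2 ℕ.+ i)} (subst (λ y → Step λ' (a i) y (a (2 ℕ.+ i))) e₁ (srs i)))
        (cong ℤ.-_ e₀))
      d≤20 210≤B up (ℕ.m≤n+m (suc d) (suc B)) lo (ℕ.≤-trans J≤ (ℕ.s≤s (ℕ.m≤n+m f d))))
  climb f i (suc w) d B J e₀ e₁ d≤20 210≤B up w≤ lo J≤ = go f J≤ (floorAt i w e₁)
    where
    go : ∀ f → suc J ℕ.≤ suc w ℕ.+ f → ∃[ g ] Floor⁺ (a i) w (a (2 ℕ.+ i)) g → Plateau i
    go f J≤ (suc g , z≡ , lo′ , up′) = crest d i w B e₀ e₁
      (λ u → lo′ (μ<-up (ℕ.*-monoˡ-≤ (suc w) {1} {suc g} (ℕ.s≤s ℕ.z≤n)) u)) up bound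
      where
      open ℕ.≤-Reasoning
      bound : suc w ℕ.+ triangle (suc d) ℕ.≤ 2 ℕ.* suc B
      bound = begin
        suc w ℕ.+ triangle (suc d)             ≤⟨ ℕ.+-monoˡ-≤ (triangle (suc d)) w≤ ⟩
        suc B ℕ.+ suc d ℕ.+ triangle (suc d)   ≡⟨ ℕ.+-assoc (suc B) (suc d) (triangle (suc d)) ⟩
        -- Slopes are at most 20 and `triangle 21` is 210, whence the lower bound on B + 1.
        suc B ℕ.+ triangle (suc (suc d))       ≤⟨ ℕ.+-monoʳ-≤ (suc B) (triangle-mono (ℕ.s≤s d≤20)) ⟩
        suc B ℕ.+ 210                          ≤⟨ ℕ.+-monoʳ-≤ (suc B) 210≤B ⟩
        suc B ℕ.+ suc B                        ≡⟨ cong (suc B ℕ.+_) (ℕ.+-identityʳ (suc B)) ⟨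
        2 ℕ.* suc B                            ∎
    -- Without fuel, w + 1 ≥ J + 1 > 1/μ contradicts the floor 0.
    go zero J≤ (zero , z≡ , lo′ , up′) = ⊥-elim (ℕ.<⇒≱ (<μ< lo up′)
      (ℕ.*-monoʳ-≤ 1 (ℕ.≤-trans J≤ (ℕ.≤-reflexive (ℕ.+-identityʳ (suc w))))))
    -- Floor 0 keeps the slope and puts w + 1 below 1/μ, so the larger of `w` and `B` serves as the
    -- next bound.
    go (suc f) J≤ (zero , z≡ , lo′ , up′) = [ keep , renew ]′ (ℕ.≤-total w B)
      where
      e₂ : a (2 ℕ.+ i) ≡ + (suc w ℕ.+ suc d)
      e₂ = trans z≡ (trans (cong (λ x → (2 ℕ.* suc w ⊖ 0) ℤ.- x) e₀)
        (trans (cong (ℤ._- (+ suc w ℤ.- + suc d)) (sym (ℤ.m-n≡m⊖n (2 ℕ.* suc w) 0)))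
          (slope-ring (+ suc w) (+ suc d))))
      next : ∀ B′ → 210 ℕ.≤ suc B′ → μ< 1 /1+ B′ → w ℕ.≤ B′ → Plateau i
      next B′ 210≤B′ up w≤B′ = later
        (climb f (suc i) (suc w ℕ.+ suc d) d B′ J (trans e₁ (cancel-ring (+ suc w) (+ suc d))) e₂
          d≤20 210≤B′ up (ℕ.s≤s (ℕ.+-monoˡ-≤ (suc d) w≤B′)) lo
          (ℕ.≤-trans J≤ (ℕ.≤-trans (ℕ.+-monoʳ-≤ (suc w) (ℕ.s≤s (ℕ.m≤n+m f d)))
            (ℕ.≤-reflexive (sym (ℕ.+-assoc (suc w) (suc d) f))))))
      keep : w ℕ.≤ B → Plateau i
      keep w≤B = next B 210≤B up w≤B
      renew : B ℕ.≤ w → Plateau i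
      renew B≤w = next w (ℕ.≤-trans 210≤B (ℕ.s≤s B≤w)) up′ ℕ.≤-refl

  -- A rational strictly between -2 and λ exceeds -2 by at least the reciprocal of its denominator.
  archimedean : ∃[ J ] 1 /1+ J <μ
  archimedean = witness (L-rounded λ' -2<λ)
    where
    witness : ∃[ r ] (- (+ 2 / 1) ℚ.< r × L λ' r) → ∃[ J ] 1 /1+ J <μ
    witness (r@record{} , -2<r , Lr) = J , lower (L-mono (subst (frac 1 J ℚ.≤_) (↥/↧ r)
      (/-≤⁺ (+ 1 ℤ.- + (2 ℕ.* suc J)) J (↥ r) J (ℤ.*-monoʳ-≤-nonNeg (+ suc J) bound))) Lr)
      where
      J = ℚ.denominator-1 r
      bound : + 1 ℤ.- + (2 ℕ.* suc J) ℤ.≤ ↥ r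
      bound = subst (+ 1 ℤ.- + (2 ℕ.* suc J) ℤ.≤_) (ℤ.*-identityʳ (↥ r))
        (ℤ.i<j⇒suc[i]≤j (/->⁻ r -[1+ 1 ] 0 -2<r))

  plateau-returns : ∀ {n} → Visits n → Plateau n → Returns n
  plateau-returns {n} b (j , n<j , e) = mirror-returns b (j ℕ.∸ n) j n<j
    (trans e (cong (a ∘ suc) j≡)) (trans (sym e) (cong a j≡))
    where
    j≡ : j ≡ j ℕ.∸ n ℕ.+ n
    j≡ = sym (ℕ.m∸n+n≡m (ℕ.<⇒≤ n<j))

  climbs-returns : ∀ n x y k → a n ≡ x → a (suc n) ≡ y → y ℤ.- x ≡ k → Visits n →
    μ< 1 /1+ 228 → T (climbs y k) → Returns n
  climbs-returns n x (+ w) (+ suc d) refl e₁ k≡ b up _ = plateau-returns b (ascend archimedean)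
    where
    w≤10 : w ℕ.≤ 10
    w≤10 = subst (λ t → ∣ t ∣ ≤ 10) e₁ (proj₂ b)
    d≤20 : suc d ℕ.≤ 20
    d≤20 = ℕ.≤-trans (ℕ.≤-reflexive (cong ∣_∣ (sym k≡)))
      (ℕ.≤-trans (ℤ.∣i-j∣≤∣i∣+∣j∣ (+ w) x) (ℕ.+-mono-≤ w≤10 (proj₁ b)))
    e₀ : a n ≡ + w ℤ.- + suc d
    e₀ = trans (solve 2 (λ x w → x := w :- (w :- x)) refl x (+ w)) (cong (λ t → + w ℤ.- t) k≡)
    ascend : ∃[ J ] 1 /1+ J <μ → Plateau n
    -- Initially 229 < 1/μ serves as B + 1. The fuel J + 1 suffices because every step raises the
    -- value by at least 1.
    ascend (J , lo) = climb (suc J) n w d 228 J e₀ e₁ d≤20 (ℕ.m≤m+n 210 19) up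
      (ℕ.≤-trans w≤10 (ℕ.m≤m+n 10 (219 ℕ.+ suc d))) lo (ℕ.m≤n+m (suc J) w)

  -- From recurrence to periodicity.

  box-returns : U λ' (+ 2 / 1) → ∀ n → Visits n → Returns n
  box-returns λ<2 n b@(b₀ , b₁) = [ from-far , from-near ]′ (located-μ {1} {229} {1} {228} (ℕ.n<1+n 229))
    where
    open Soundness n b
    from-far : 1 /1+ 229 <μ → Returns n
    from-far lo = run-sound 2000 0 (a (suc n)) far refl (lo , upper λ<2)
      (allBox-sound farCheck far-checked (a n) (a (suc n)) b)
    from-near : μ< 1 /1+ 228 → Returns n
    from-near up = [ climbs-returns n (a n) (a (suc n)) _ refl refl refl b up
                   , run-sound 2000 0 (a (suc n)) near refl (lower -2<λ , up) ]′
      (Equivalence.to T-∨ (allBox-sound nearCheck near-checked (a n) (a (suc n)) b))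

  -- `Periodic` demands a period from index 0 on, so injectivity carries the coincidence of two
  -- pairs back to the start.
  rewind : ∀ t p → a t ≡ a (t ℕ.+ p) → a (suc t) ≡ a (suc (t ℕ.+ p)) → a 0 ≡ a p × a 1 ≡ a (suc p)
  rewind zero    p e₀ e₁ = e₀ , e₁
  rewind (suc t) p e₀ e₁ = rewind t p (step-backward t (t ℕ.+ p) e₀ e₁) e₀

  replay : ∀ p → a 0 ≡ a p → a 1 ≡ a (suc p) → ∀ n → a n ≡ a (n ℕ.+ p) × a (suc n) ≡ a (suc (n ℕ.+ p))
  replay p e₀ e₁ zero    = e₀ , e₁
  replay p e₀ e₁ (suc n) = let (e , e′) = replay p e₀ e₁ n in e′ , step-forward n (n ℕ.+ p) e e′

  repeat-periodic : ∀ {s t} → s ℕ.< t → a s ≡ a t → a (suc s) ≡ a (suc t) → Periodic a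
  repeat-periodic {s} {t} s<t e₀ e₁ = p , ℕ.>-nonZero (ℕ.m<n⇒0<n∸m s<t) , λ n →
    sym (proj₁ (replay p (proj₁ start) (proj₂ start) n))
    where
    p = t ℕ.∸ s
    t≡ : t ≡ s ℕ.+ p
    t≡ = sym (ℕ.m+[n∸m]≡n (ℕ.<⇒≤ s<t))
    start = rewind s p (trans e₀ (cong a t≡)) (trans e₁ (cong (a ∘ suc) t≡))

  recurrent-periodic : (∀ n → Visits n → Returns n) → Visits 0 → Periodic a
  recurrent-periodic returns b =
    -- Among 442 visits to 441 pairs, two see the same pair.
    conclude (Fin.pigeonhole (ℕ.n<1+n (21 ℕ.* 21)) (λ i → pairAt (toℕ i)))
    where
    visit : ℕ → ∃[ n ] Visits n
    visit zero    = 0 , b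
    visit (suc k) = let (s , _ , b′) = returns (proj₁ (visit k)) (proj₂ (visit k)) in s , b′
    time : ℕ → ℕ
    time k = proj₁ (visit k)
    time-< : ∀ {i j} → i ℕ.<′ j → time i ℕ.< time j
    time-< {i} ℕ.<′-base = proj₁ (proj₂ (returns (time i) (proj₂ (visit i))))
    time-< {i} (ℕ.<′-step {j} i<j) =
      ℕ.<-trans (time-< i<j) (proj₁ (proj₂ (returns (time j) (proj₂ (visit j)))))
    pairAt : ℕ → Fin (21 ℕ.* 21)
    pairAt k = encode (a (time k)) (a (suc (time k))) (proj₂ (visit k))
    conclude : ∃[ i ] ∃[ j ] i Fin.< j × pairAt (toℕ i) ≡ pairAt (toℕ j) → Periodic a
    conclude (i , j , i<j , e) =
      let (e₀ , e₁) = encode-injective (proj₂ (visit (toℕ i))) (proj₂ (visit (toℕ j))) e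
      in repeat-periodic (time-< (ℕ.<⇒<′ i<j)) e₀ e₁

theorem3 : (a : ℕ → ℤ) (λ' : ℝ) → ∣ a 0 ∣ ≤ 10 → ∣ a 1 ∣ ≤ 10 →
    InOpen λ' (- (Data.Integer.+ 2 / 1)) (Data.Integer.+ 2 / 1) →
    SRS λ' a → Periodic a
theorem3 a λ' a₀≤10 a₁≤10 (-2<λ , λ<2) srs =
  recurrent-periodic (box-returns λ<2) (a₀≤10 , a₁≤10)
  where open Orbit λ' -2<λ a srs
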